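{- Let $Q=(q_{ij})$ be the transition matrix of a discrete-time, time-homogeneous Markov chain on a finite state space $S$, let $i\in S$ be a fixed initial state, let $k$ be a field, and let $n\ge 1$ be an integer. Let $J_n(i)\subseteq k[x_s:s\in S]$ be the occupation ideal, generated by the monomials $m_\gamma$ over all admissible trajectories $\gamma$ of length $n$ starting at $i$. Then all minimal monomial generators of $J_n(i)$ have total degree $n+1$. Consequently, \[ a_i(n)=\mu(J_n(i)), \] where $a_i(n)$ is the number of distinct occupation vectors of admissible trajectories of length $n$ starting at $i$, and $\mu(J_n(i))$ is the number of minimal monomial generators of $J_n(i)$.
   Context: The support graph of $Q$ is the directed graph $G_B=(S,E)$ with $E=\{(s,t)\in S\times S: q_{st}>0\}$ (loops allowed). An admissible trajectory of length $n$ starting at $i$ is a sequence $\gamma=(i_0,i_1,\ldots,i_n)$ of states with $i_0=i$ and $(i_{r},i_{r+1})\in E$ for all $0\le r<n$. It is regarded as the word $w_\gamma=i_0i_1\cdots i_n$ over the alphabet $S$, and $L_i^{(n)}$ denotes the set of all such words (identified with the trajectories) for the given $n$. The occupation vector (Parikh vector) of $\gamma$ is $\Psi(w_\gamma)=(\alpha_s)_{s\in S}\in\mathbb{N}^{S}$, where $\alpha_s=\#\{r\in\{0,\ldots,n\}: i_r=s\}$. The monomial associated with $\gamma$ is $m_\gamma=\prod_{s\in S}x_s^{\alpha_s}$ in the polynomial ring $R=k[x_s:s\in S]$, with one variable per state. The occupation ideal is $J_n(i)=\langle m_\gamma:\gamma\in L_i^{(n)}\rangle\subseteq R$. The occupation-pattern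 growth function is $a_i(n)=\#\{\Psi(w): w\in L_i^{(n)}\}$. The minimal monomial generators of a monomial ideal are the elements of its unique minimal generating set of monomials (the monomials in the ideal that are minimal with respect to divisibility). -}

module Defs where

open import Level using (Level; _⊔_) renaming (suc to lsuc)
open import Algebra.Apartness.Bundles using (HeytingField)
open import Algebra.Properties.Monoid.Sum using (sum)
open import Data.Bool.Base using (if_then_else_)
open import Data.Fin.Base using (Fin; suc; inject₁)
open import Data.Fin.Properties using () renaming (_≟_ to _≟ᶠ_)
open import Data.List.Base using (List; []; _∷_; _++_; length; cartesianProductWith)
open import Data.List.Membership.Propositional using (_∈_)
open import Data.List.Relation.Unary.Unique.Propositional using (Unique)
open import Data.Nat.Base using (ℕ) renaming (suc to 1+_; _+_ to _+ℕ_)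
open import Data.Nat.Properties using () renaming (_≟_ to _≟ℕ_)
open import Data.Product.Base using (Σ-syntax; ∃-syntax; _×_; _,_)
open import Data.Sum.Base using (_⊎_)
open import Data.Vec.Base as Vec using (Vec; head; lookup; tabulate; zipWith; count)
open import Data.Vec.Properties using (≡-dec)
open import Function.Bundles using (_⇔_)
open import Relation.Binary.Core using (Rel)
open import Relation.Binary.PropositionalEquality using (_≡_)
open import Relation.Binary.Structures using (IsStrictTotalOrder)
open import Relation.Nullary.Decidable using (does)

private
  variable
    a p c ℓ₁ ℓ₂ ℓ₃ : Level

-- P is a finite set with exactly k elements.  P need not be
-- proposition-valued, so elements are counted in A rather than in Σ A P.
HasCardinality : {A : Set a} → (A → Set p) → ℕ → Set (a ⊔ p)
HasCardinality {A = A} P k =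
  Σ[ xs ∈ List A ] Unique xs × length xs ≡ k × (∀ x → x ∈ xs ⇔ P x)

-- The transition probabilities live in an arbitrary (totally) ordered field;
-- the classical case is the field of real numbers.
record OrderedField c ℓ₁ ℓ₂ ℓ₃ : Set (lsuc (c ⊔ ℓ₁ ⊔ ℓ₂ ⊔ ℓ₃)) where
  field
    heytingField : HeytingField c ℓ₁ ℓ₂

  open HeytingField heytingField public

  infix 4 _<_ _≤_
  field
    _<_                : Rel Carrier ℓ₃
    isStrictTotalOrder : IsStrictTotalOrder _≈_ _<_
    +-monoˡ-<          : ∀ {x y} z → x < y → (x + z) < (y + z)
    *-pos              : ∀ {x y} → 0# < x → 0# < y → 0# < (x * y)

  _≤_ : Rel Carrier (ℓ₁ ⊔ ℓ₃)
  x ≤ y = x < y ⊎ x ≈ y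

module MarkovChain (F : OrderedField c ℓ₁ ℓ₂ ℓ₃) where
  open OrderedField F

  record TransitionMatrix (N : ℕ) : Set (c ⊔ ℓ₁ ⊔ ℓ₃) where
    field
      q        : Fin N → Fin N → Carrier
      q-nonneg : ∀ s t → 0# ≤ q s t
      q-rowSum : ∀ s → sum (record { isMonoid = +-isMonoid }) (q s) ≈ 1#

  open TransitionMatrix

  Edge : ∀ {N} → TransitionMatrix N → Fin N → Fin N → Set ℓ₃
  Edge Q s t = 0# < q Q s t

  IsTrajectory : ∀ {N} → TransitionMatrix N → Fin N → (n : ℕ) → Vec (Fin N) (1+ n) → Set ℓ₃
  IsTrajectory Q i n w =
    head w ≡ i × (∀ (r : Fin n) → Edge Q (lookup w (inject₁ r)) (lookup w (suc r)))

Ψ : ∀ {N m} → Vec (Fin N) m → Vec ℕ N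
Ψ w = tabulate λ s → count (_≟ᶠ s) w

-- A monomial ∏ₛ xₛ^αₛ is represented by its exponent vector α.
Monomial : ℕ → Set
Monomial N = Vec ℕ N

infixl 7 _·_
_·_ : ∀ {N} → Monomial N → Monomial N → Monomial N
_·_ = zipWith _+ℕ_

infix 4 _∣_
_∣_ : ∀ {N} → Monomial N → Monomial N → Set
α ∣ β = ∃[ γ ] γ · α ≡ β

degree : ∀ {N} → Monomial N → ℕ
degree = Vec.sum

module Polynomials (k : HeytingField c ℓ₁ ℓ₂) (N : ℕ) where
  private module k = HeytingField k

  -- A polynomial in x₀,…,x_{N-1} is a finite formal sum of terms; terms with
  -- equal monomials may repeat and zero coefficients may occur, so polynomials
  -- are compared by _≈ᴾ_ and never by _≡_.
  Poly : Set c
  Poly = List (k.Carrier × Monomial N)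

  coeff : Poly → Monomial N → k.Carrier
  coeff []            β = k.0#
  coeff ((a , α) ∷ f) β =
    (if does (≡-dec _≟ℕ_ α β) then a else k.0#) k.+ coeff f β

  infix 4 _≈ᴾ_
  _≈ᴾ_ : Rel Poly ℓ₁
  f ≈ᴾ g = ∀ β → coeff f β k.≈ coeff g β

  0ᴾ : Poly
  0ᴾ = []

  infixl 6 _+ᴾ_
  _+ᴾ_ : Poly → Poly → Poly
  _+ᴾ_ = _++_

  infixl 7 _*ᴾ_
  _*ᴾ_ : Poly → Poly → Poly
  _*ᴾ_ = cartesianProductWith λ { (a , α) (b , β) → (a k.* b) , (α · β) }

  monomial : Monomial N → Poly
  monomial α = (k.1# , α) ∷ []

  -- The smallest ideal of k[x₀,…,x_{N-1}] containing G.
  data ⟨_⟩ (G : Poly → Set p) : Poly → Set (c ⊔ ℓ₁ ⊔ p) where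
    generator : ∀ {f} → G f → ⟨ G ⟩ f
    zero      : ⟨ G ⟩ 0ᴾ
    add       : ∀ {f g} → ⟨ G ⟩ f → ⟨ G ⟩ g → ⟨ G ⟩ (f +ᴾ g)
    scale     : ∀ h {f} → ⟨ G ⟩ f → ⟨ G ⟩ (h *ᴾ f)
    resp      : ∀ {f g} → f ≈ᴾ g → ⟨ G ⟩ f → ⟨ G ⟩ g

  IsMinimalMonomialGenerator : (Poly → Set p) → Monomial N → Set p
  IsMinimalMonomialGenerator I α =
    I (monomial α) × (∀ β → I (monomial β) → β ∣ α → β ≡ α)

module Occupation
  {f₁ f₂ f₃ f₄ : Level} (F : OrderedField f₁ f₂ f₃ f₄)
  (k : HeytingField c ℓ₁ ℓ₂)
  {N : ℕ} (Q : MarkovChain.TransitionMatrix F N) (i : Fin N) (n : ℕ) where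
  open MarkovChain F
  open Polynomials k N

  IsOccupationVector : Vec ℕ N → Set f₄
  IsOccupationVector α = ∃[ w ] IsTrajectory Q i n w × Ψ w ≡ α

  J : Poly → Set (c ⊔ ℓ₁ ⊔ f₄)
  J = ⟨ (λ f → ∃[ w ] IsTrajectory Q i n w × f ≡ monomial (Ψ w)) ⟩

  infix 4 a≔_ μ≔_

  -- a≔ m and μ≔ m say that the counting functions aᵢ(n) and μ(Jₙ(i)) are
  -- defined (the sets counted are finite) and take the value m.
  a≔_ : ℕ → Set f₄
  a≔ m = HasCardinality IsOccupationVector m

  μ≔_ : ℕ → Set (c ⊔ ℓ₁ ⊔ f₄)
  μ≔ m = HasCardinality (IsMinimalMonomialGenerator J) m

{-# OPTIONS --safe #-}

-- Every word of length n + 1 has a Parikh vector of degree n + 1, so no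
-- occupation monomial properly divides another.  The polynomials whose
-- coefficients vanish off an upward closed set of monomials form an ideal;
-- hence a monomial of J is divisible by an occupation monomial, and the minimal
-- monomial generators are exactly the occupation monomials.  Divisibility by an
-- occupation monomial is decidable, since there are finitely many words and the
-- order of the field of transition probabilities is decidable.

module Submission where

open import Defs
open import Level using (Level)
open import Algebra.Apartness.Bundles using (HeytingField)
open import Data.Fin.Base using (Fin)
open import Data.Nat.Base using (ℕ; _≤_; _+_)
open import Data.Product.Base using (_×_; ∃-syntax)
open import Relation.Binary.PropositionalEquality using (_≡_)

import Algebra.Apartness.Properties.HeytingCommutativeRing as HeytingProperties
import Data.Fin.Properties as Finₚ
import Data.List.Relation.Unary.Any as Any
import Relation.Binary.Reasoning.Setoid as ≈-Reasoning
open import Data.Bool.Base using (if_then_else_)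
open import Data.Fin.Base using (zero; suc)
open import Data.List.Base using (List; []; _∷_; map; filter; deduplicate; length; allFin; cartesianProductWith)
open import Data.List.Membership.Propositional using (_∈_; find; lose)
open import Data.List.Membership.Propositional.Properties using (∈-allFin; ∈-cartesianProductWith⁺; ∈-map∘filter⁺; ∈-map∘filter⁻; ∈-deduplicate⁺; ∈-deduplicate⁻)
open import Data.List.Relation.Unary.Unique.DecPropositional.Properties using (deduplicate-!)
open import Data.Nat.Base using (zero; suc)
open import Data.Nat.Properties using (+-assoc; +-comm; +-suc; +-cancelˡ-≡; +-cancelʳ-≡; m≤n+m; m∸n+n≡m; m+n≡0⇒m≡0; m+n≡0⇒n≡0; ≤-trans; ≤-reflexive; ≤-antisym) renaming (_≟_ to _≟ℕ_; _≤?_ to _≤ℕ?_)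
open import Data.Product.Base using (_,_)
open import Data.Vec.Base using (Vec; []; _∷_; head; replicate; sum; tabulate)
open import Data.Vec.Properties using (≡-dec; ∷-injective; zipWith-assoc; zipWith-comm; zipWith-identityˡ)
open import Function.Base using (_∘_; id)
open import Function.Bundles using (_⇔_; mk⇔; module Equivalence)
open import Relation.Binary.PropositionalEquality using (refl; sym; trans; cong; cong₂; subst; module ≡-Reasoning)
open import Relation.Binary.Structures using (module IsStrictTotalOrder)
open import Relation.Nullary.Decidable using (Dec; yes; no; does; map′; _×-dec_; decidable-stable)
open import Relation.Nullary.Negation using (¬_; contradiction)
open import Relation.Unary using (Decidable)

private
  variable
    a b c p u ℓ₁ ℓ₂ f₁ f₂ f₃ f₄ : Level
    N : ℕ

HasCardinality-⇔ : {A : Set a} {P : A → Set p} {R : A → Set b} {m : ℕ} →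
                   (∀ x → P x ⇔ R x) → HasCardinality P m → HasCardinality R m
HasCardinality-⇔ P⇔R (xs , unique , len , ∈⇔P) =
  xs , unique , len , λ x →
    mk⇔ (Equivalence.to (P⇔R x) ∘ Equivalence.to (∈⇔P x))
        (Equivalence.from (∈⇔P x) ∘ Equivalence.from (P⇔R x))

-- Monomials

·-assoc : (α β γ : Monomial N) → (α · β) · γ ≡ α · (β · γ)
·-assoc = zipWith-assoc +-assoc

·-comm : (α β : Monomial N) → α · β ≡ β · α
·-comm = zipWith-comm +-comm

-- Multiplication by a fixed monomial is injective, so distinct terms of a polynomial stay distinct
-- when shifted by `α`.
·-cancelˡ : (α : Monomial N) {β γ : Monomial N} → α · β ≡ α · γ → β ≡ γ
·-cancelˡ []      {[]}    {[]}    _  = refl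
·-cancelˡ (x ∷ α) {y ∷ β} {z ∷ γ} eq with ∷-injective eq
... | eq₁ , eq₂ = cong₂ _∷_ (+-cancelˡ-≡ x y z eq₁) (·-cancelˡ α eq₂)

∣-refl : {α : Monomial N} → α ∣ α
∣-refl {N} {α} = replicate N 0 , zipWith-identityˡ (λ _ → refl) α

∣-trans : {α β γ : Monomial N} → α ∣ β → β ∣ γ → α ∣ γ
∣-trans {α = α} (δ , refl) (ε , refl) = ε · δ , ·-assoc ε δ α

infix 4 _∣?_
_∣?_ : (α β : Monomial N) → Dec (α ∣ β)
[]      ∣? []      = yes ([] , refl)
(x ∷ α) ∣? (y ∷ β) = map′ to from ((x ≤ℕ? y) ×-dec (α ∣? β))
  where
  to : x ≤ y × α ∣ β → (x ∷ α) ∣ (y ∷ β)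
  -- The exponent left open is the truncated difference `y ∸ x`, exact because `x ≤ y`.
  to (x≤y , γ , eq) = _ ∷ γ , cong₂ _∷_ (m∸n+n≡m x≤y) eq

  from : (x ∷ α) ∣ (y ∷ β) → x ≤ y × α ∣ β
  from (z ∷ γ , refl) = m≤n+m x z , γ , refl

degree-· : (α β : Monomial N) → degree (α · β) ≡ degree α + degree β
degree-· []      []      = refl
degree-· (x ∷ α) (y ∷ β) = begin
  (x + y) + degree (α · β)         ≡⟨ cong (x + y +_) (degree-· α β) ⟩
  (x + y) + (degree α + degree β)  ≡⟨ +-assoc x y _ ⟩
  x + (y + (degree α + degree β))  ≡⟨ cong (x +_) (+-assoc y (degree α) (degree β)) ⟨
  x + ((y + degree α) + degree β)  ≡⟨ cong (λ z → x + (z + degree β)) (+-comm y (degree α)) ⟩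
  x + ((degree α + y) + degree β)  ≡⟨ cong (x +_) (+-assoc (degree α) y (degree β)) ⟩
  x + (degree α + (y + degree β))  ≡⟨ +-assoc x (degree α) _ ⟨
  (x + degree α) + (y + degree β)  ∎
  where open ≡-Reasoning

∣⇒degree≤ : {α β : Monomial N} → α ∣ β → degree α ≤ degree β
∣⇒degree≤ {α = α} (γ , refl) =
  ≤-trans (m≤n+m (degree α) (degree γ)) (≤-reflexive (sym (degree-· γ α)))

degree≡0⇒identityˡ : (γ α : Monomial N) → degree γ ≡ 0 → γ · α ≡ α
degree≡0⇒identityˡ []      []      _  = refl
degree≡0⇒identityˡ (z ∷ γ) (x ∷ α) eq =
  cong₂ _∷_ (cong (_+ x) (m+n≡0⇒m≡0 z eq)) (degree≡0⇒identityˡ γ α (m+n≡0⇒n≡0 z eq))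

-- Degree is additive, so the cofactor has degree zero and is therefore the unit monomial.
∣∧degree≡⇒≡ : {α β : Monomial N} → α ∣ β → degree α ≡ degree β → α ≡ β
∣∧degree≡⇒≡ {α = α} (γ , refl) eq =
  sym (degree≡0⇒identityˡ γ α
    (+-cancelʳ-≡ (degree α) (degree γ) 0 (sym (trans eq (degree-· γ α)))))

-- Parikh vectors

-- Prefixing the letter `x` to a word raises exactly one coordinate of its Parikh vector; the
-- conditional is the form to which `count` unfolds on a nonempty word.
sum-tabulate-incr : (x : Fin N) (f : Fin N → ℕ) →
  sum (tabulate λ s → (if does (x Finₚ.≟ s) then suc else id) (f s)) ≡ suc (sum (tabulate f))
sum-tabulate-incr zero    f = refl
sum-tabulate-incr (suc x) f = begin
  f zero + sum (tabulate λ s → (if does (x Finₚ.≟ s) then suc else id) (f (suc s)))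
    ≡⟨ cong (f zero +_) (sum-tabulate-incr x (f ∘ suc)) ⟩
  f zero + suc (sum (tabulate (f ∘ suc)))
    ≡⟨ +-suc (f zero) _ ⟩
  suc (f zero + sum (tabulate (f ∘ suc))) ∎
  where open ≡-Reasoning

degree-Ψ : {m : ℕ} (w : Vec (Fin N) m) → degree (Ψ w) ≡ m
degree-Ψ {N = N} [] = sum-zero N
  where
  sum-zero : ∀ N → sum (tabulate {n = N} λ _ → 0) ≡ 0
  sum-zero zero    = refl
  sum-zero (suc N) = sum-zero N
degree-Ψ (x ∷ w) = trans (sum-tabulate-incr x _) (cong suc (degree-Ψ w))

Ψ-∣⇒≡ : {m : ℕ} (v w : Vec (Fin N) m) → Ψ v ∣ Ψ w → Ψ v ≡ Ψ w
Ψ-∣⇒≡ v w Ψv∣Ψw = ∣∧degree≡⇒≡ Ψv∣Ψw (trans (degree-Ψ v) (sym (degree-Ψ w)))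

words : (N m : ℕ) → List (Vec (Fin N) m)
words N zero    = [] ∷ []
words N (suc m) = cartesianProductWith _∷_ (allFin N) (words N m)

∈-words : {m : ℕ} (w : Vec (Fin N) m) → w ∈ words N m
∈-words []      = Any.here refl
∈-words (x ∷ w) = ∈-cartesianProductWith⁺ _∷_ (∈-allFin x) (∈-words w)

-- Ideals of polynomials

module _ (k : HeytingField c ℓ₁ ℓ₂) (N : ℕ) where
  open HeytingField k using (Carrier; 0#; 1#; _*_; setoid; +-cong; +-congˡ; +-identityˡ; +-identityʳ; zeroʳ; distribˡ; *-congˡ; #-irrefl; heytingCommutativeRing)
    renaming (_≈_ to _≈ᵏ_; _+_ to _+ᵏ_; refl to ≈-refl; sym to ≈-sym; trans to ≈-trans; +-assoc to +ᵏ-assoc)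
  open Polynomials k N
  open ≈-Reasoning setoid

  1≉0 : ¬ (1# ≈ᵏ 0#)
  1≉0 1≈0 = #-irrefl 1≈0 (HeytingProperties.1#0 heytingCommutativeRing)

  coeff-+ : ∀ f g β → coeff (f +ᴾ g) β ≈ᵏ coeff f β +ᵏ coeff g β
  coeff-+ []            g β = ≈-sym (+-identityˡ _)
  coeff-+ ((a , α) ∷ f) g β = begin
    t +ᵏ coeff (f +ᴾ g) β            ≈⟨ +-congˡ (coeff-+ f g β) ⟩
    t +ᵏ (coeff f β +ᵏ coeff g β)    ≈⟨ +ᵏ-assoc t _ _ ⟨
    (t +ᵏ coeff f β) +ᵏ coeff g β    ∎
    where t = if does (≡-dec _≟ℕ_ α β) then a else 0#

  coeff-monomial : ∀ α → coeff (monomial α) α ≈ᵏ 1#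
  coeff-monomial α with ≡-dec _≟ℕ_ α α
  ... | yes _  = +-identityʳ 1#
  ... | no α≢α = contradiction refl α≢α

  coeff-monomial-≢ : ∀ {α β} → ¬ (α ≡ β) → coeff (monomial α) β ≈ᵏ 0#
  coeff-monomial-≢ {α} {β} α≢β with ≡-dec _≟ℕ_ α β
  ... | yes α≡β = contradiction α≡β α≢β
  ... | no _    = +-identityʳ 0#

  -- One row of the product: `(t ∷ h) *ᴾ f` is by definition `mulTerm t f +ᴾ h *ᴾ f`.
  mulTerm : Carrier × Monomial N → Poly → Poly
  mulTerm (a , α) = map λ (b , β) → (a * b) , (α · β)

  -- Since `α` cancels, the tests `α · β ≡ α · γ` and `β ≡ γ` always agree, so the coefficients are
  -- merely shifted and scaled.
  coeff-mulTerm : ∀ a α f γ → coeff (mulTerm (a , α) f) (α · γ) ≈ᵏ a * coeff f γ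
  coeff-mulTerm a α []            γ = ≈-sym (zeroʳ a)
  coeff-mulTerm a α ((b , β) ∷ f) γ = begin
    (if does (≡-dec _≟ℕ_ (α · β) (α · γ)) then a * b else 0#) +ᵏ coeff (mulTerm (a , α) f) (α · γ)
      ≈⟨ +-cong head-term (coeff-mulTerm a α f γ) ⟩
    a * (if does (≡-dec _≟ℕ_ β γ) then b else 0#) +ᵏ a * coeff f γ
      ≈⟨ distribˡ a _ _ ⟨
    a * ((if does (≡-dec _≟ℕ_ β γ) then b else 0#) +ᵏ coeff f γ) ∎
    where
    head-term : (if does (≡-dec _≟ℕ_ (α · β) (α · γ)) then a * b else 0#)
                ≈ᵏ a * (if does (≡-dec _≟ℕ_ β γ) then b else 0#)
    head-term with ≡-dec _≟ℕ_ (α · β) (α · γ) | ≡-dec _≟ℕ_ β γ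
    ... | yes _   | yes _  = ≈-refl
    ... | yes eq  | no β≢γ = contradiction (·-cancelˡ α eq) β≢γ
    ... | no neq  | yes eq = contradiction (cong (α ·_) eq) neq
    ... | no _    | no _   = ≈-sym (zeroʳ a)

  coeff-mulTerm-∤ : ∀ a α f {β} → ¬ (α ∣ β) → coeff (mulTerm (a , α) f) β ≈ᵏ 0#
  coeff-mulTerm-∤ a α []            α∤β = ≈-refl
  coeff-mulTerm-∤ a α ((b , γ) ∷ f) {β} α∤β with ≡-dec _≟ℕ_ (α · γ) β
  ... | yes eq = contradiction (γ , trans (·-comm γ α) eq) α∤β
  ... | no _   = ≈-trans (+-identityˡ _) (coeff-mulTerm-∤ a α f α∤β)

  -- Phrased through coefficients rather than listed terms, because a list may contain zero or
  -- cancelling terms and only coefficients respect `_≈ᴾ_`.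
  VanishesOff : (Monomial N → Set u) → Poly → Set _
  VanishesOff U f = ∀ β → ¬ U β → coeff f β ≈ᵏ 0#

  UpwardClosed : (Monomial N → Set u) → Set _
  UpwardClosed U = ∀ {α β} → α ∣ β → U α → U β

  monomial-vanishesOff : {U : Monomial N → Set u} → ∀ {α} → U α → VanishesOff U (monomial α)
  monomial-vanishesOff {α = α} α∈U β β∉U = coeff-monomial-≢ {α} {β} λ { refl → β∉U α∈U }

  -- If `α` lay outside `U`, its coefficient 1 would be 0. This refutes only the negation of `U α`;
  -- decidability recovers `U α` itself.
  vanishesOff-monomial : {U : Monomial N → Set u} → Decidable U →
                         ∀ {α} → VanishesOff U (monomial α) → U α
  vanishesOff-monomial U? {α} α≈0 = decidable-stable (U? α) λ α∉U →
    1≉0 (≈-trans (≈-sym (coeff-monomial α)) (α≈0 α α∉U))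

  module _ {U : Monomial N → Set u} (U↑ : UpwardClosed U) where

    vanishesOff-+ : ∀ f g → VanishesOff U f → VanishesOff U g → VanishesOff U (f +ᴾ g)
    vanishesOff-+ f g f≈0 g≈0 β β∉U = begin
      coeff (f +ᴾ g) β          ≈⟨ coeff-+ f g β ⟩
      coeff f β +ᵏ coeff g β    ≈⟨ +-cong (f≈0 β β∉U) (g≈0 β β∉U) ⟩
      0# +ᵏ 0#                  ≈⟨ +-identityʳ 0# ⟩
      0#                        ∎

    -- The coefficient at `β` is zero unless `α` divides `β`, and otherwise is a multiple of the
    -- coefficient of `f` at the quotient.
    vanishesOff-mulTerm : ∀ t f → VanishesOff U f → VanishesOff U (mulTerm t f)
    vanishesOff-mulTerm (a , α) f f≈0 β β∉U with α ∣? β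
    ... | no α∤β         = coeff-mulTerm-∤ a α f α∤β
    ... | yes (γ , γα≡β) = begin
      coeff (mulTerm (a , α) f) β        ≡⟨ cong (coeff (mulTerm (a , α) f)) αγ≡β ⟨
      coeff (mulTerm (a , α) f) (α · γ)  ≈⟨ coeff-mulTerm a α f γ ⟩
      -- The quotient `γ` divides `β`, so `U γ` would force `U β` by upward closure.
      a * coeff f γ                      ≈⟨ *-congˡ (f≈0 γ (β∉U ∘ U↑ (α , αγ≡β))) ⟩
      a * 0#                             ≈⟨ zeroʳ a ⟩
      0#                                 ∎
      where
      αγ≡β : α · γ ≡ β
      αγ≡β = trans (·-comm α γ) γα≡β

    vanishesOff-* : ∀ h f → VanishesOff U f → VanishesOff U (h *ᴾ f)
    vanishesOff-* []      f f≈0 β β∉U = ≈-refl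
    vanishesOff-* (t ∷ h) f f≈0 =
      vanishesOff-+ (mulTerm t f) (h *ᴾ f) (vanishesOff-mulTerm t f f≈0) (vanishesOff-* h f f≈0)

    ideal-vanishesOff : {G : Poly → Set p} → (∀ {f} → G f → VanishesOff U f) →
                        ∀ {f} → ⟨ G ⟩ f → VanishesOff U f
    ideal-vanishesOff G≈0 (generator g)         = G≈0 g
    ideal-vanishesOff G≈0 zero                  = λ _ _ → ≈-refl
    ideal-vanishesOff G≈0 (add {f} {g} f∈ g∈)   =
      vanishesOff-+ f g (ideal-vanishesOff G≈0 f∈) (ideal-vanishesOff G≈0 g∈)
    ideal-vanishesOff G≈0 (scale h {f} f∈)      = vanishesOff-* h f (ideal-vanishesOff G≈0 f∈)
    ideal-vanishesOff G≈0 (resp f≈g f∈) β β∉U   =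
      ≈-trans (≈-sym (f≈g β)) (ideal-vanishesOff G≈0 f∈ β β∉U)

-- Trajectories

module _ (F : OrderedField f₁ f₂ f₃ f₄) (k : HeytingField c ℓ₁ ℓ₂)
         (Q : MarkovChain.TransitionMatrix F N) (i : Fin N) (n : ℕ) where
  open MarkovChain F
  open Polynomials k N
  open Occupation F k Q i n

  isTrajectory? : Decidable (IsTrajectory Q i n)
  isTrajectory? w = (head w Finₚ.≟ i) ×-dec Finₚ.all? λ r →
    IsStrictTotalOrder._<?_ (OrderedField.isStrictTotalOrder F) _ _

  -- Different trajectories can share a Parikh vector, so duplicates are removed before counting.
  occupationVectors : List (Vec ℕ N)
  occupationVectors = deduplicate (≡-dec _≟ℕ_) (map Ψ (filter isTrajectory? (words N (suc n))))

  ∈-occupationVectors : ∀ α → α ∈ occupationVectors ⇔ IsOccupationVector α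
  ∈-occupationVectors α = mk⇔ to from
    where
    to : α ∈ occupationVectors → IsOccupationVector α
    to α∈ with ∈-map∘filter⁻ Ψ isTrajectory? {xs = words N (suc n)} (∈-deduplicate⁻ (≡-dec _≟ℕ_) _ α∈)
    ... | w , _ , α≡Ψw , traj = w , traj , sym α≡Ψw

    from : IsOccupationVector α → α ∈ occupationVectors
    from (w , traj , Ψw≡α) = ∈-deduplicate⁺ (≡-dec _≟ℕ_)
      (∈-map∘filter⁺ Ψ isTrajectory? {xs = words N (suc n)} (w , ∈-words w , sym Ψw≡α , traj))

  occupationVectors-cardinality : a≔ length occupationVectors
  occupationVectors-cardinality =
    occupationVectors , deduplicate-! (≡-dec _≟ℕ_) _ , refl , ∈-occupationVectors

  -- The upward closed set generated by the occupation vectors; it will turn out to contain the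
  -- exponents of all monomials in `J`.
  OccupationMultiple : Monomial N → Set f₄
  OccupationMultiple β = ∃[ α ] IsOccupationVector α × α ∣ β

  occupationMultiple? : Decidable OccupationMultiple
  occupationMultiple? β = map′ to from (Any.any? (_∣? β) occupationVectors)
    where
    to : Any.Any (_∣ β) occupationVectors → OccupationMultiple β
    to any with find any
    ... | α , α∈ , α∣β = α , Equivalence.to (∈-occupationVectors α) α∈ , α∣β

    from : OccupationMultiple β → Any.Any (_∣ β) occupationVectors
    from (α , occ , α∣β) = lose (Equivalence.from (∈-occupationVectors α) occ) α∣β

  occupationMultiple-↑ : UpwardClosed k N OccupationMultiple
  occupationMultiple-↑ α∣β (γ , occ , γ∣α) = γ , occ , ∣-trans γ∣α α∣β

  occupationMonomial∈J : ∀ {α} → IsOccupationVector α → J (monomial α)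
  occupationMonomial∈J (w , traj , refl) = generator (w , traj , refl)

  monomial∈J⇒occupationMultiple : ∀ {β} → J (monomial β) → OccupationMultiple β
  monomial∈J⇒occupationMultiple β∈J =
    -- Every generator is supported in `OccupationMultiple`, hence so is every element of `J`, in
    -- particular `monomial β`.
    vanishesOff-monomial k N occupationMultiple?
      (ideal-vanishesOff k N occupationMultiple-↑ generators β∈J)
    where
    generators : ∀ {f} → ∃[ w ] IsTrajectory Q i n w × f ≡ monomial (Ψ w) →
                 VanishesOff k N OccupationMultiple f
    generators (w , traj , refl) = monomial-vanishesOff k N
      (Ψ w , (w , traj , refl) , ∣-refl)

  occupationVector⇔minimal : ∀ α → IsOccupationVector α ⇔ IsMinimalMonomialGenerator J α
  occupationVector⇔minimal α = mk⇔ to from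
    where
    to : IsOccupationVector α → IsMinimalMonomialGenerator J α
    to occ@(w , traj , refl) = occupationMonomial∈J occ , minimal
      where
      minimal : ∀ β → J (monomial β) → β ∣ Ψ w → β ≡ Ψ w
      minimal β β∈J β∣Ψw with monomial∈J⇒occupationMultiple β∈J
      -- Here `β` lies between `Ψ v` and `Ψ w` in divisibility. The outer two coincide because both
      -- words have length `suc n`, which squeezes the degree of `β`.
      ... | _ , (v , _ , refl) , Ψv∣β = ∣∧degree≡⇒≡ β∣Ψw
        (≤-antisym (∣⇒degree≤ β∣Ψw)
          (subst (λ γ → degree γ ≤ degree β) (Ψ-∣⇒≡ v w (∣-trans Ψv∣β β∣Ψw)) (∣⇒degree≤ Ψv∣β)))

    from : IsMinimalMonomialGenerator J α → IsOccupationVector α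
    from (α∈J , minimal) with monomial∈J⇒occupationMultiple α∈J
    -- The occupation monomial `β` lies in `J` and divides `α`, so minimality identifies the two.
    ... | β , occ , β∣α = subst IsOccupationVector (minimal β (occupationMonomial∈J occ) β∣α) occ

proposition4p1 : ∀ {c ℓ₁ ℓ₂ f₁ f₂ f₃ f₄ : Level}
    (F : OrderedField f₁ f₂ f₃ f₄)
    (N : ℕ) (Q : MarkovChain.TransitionMatrix F N) (i : Fin N)
    (k : HeytingField c ℓ₁ ℓ₂)
    (n : ℕ) → 1 ≤ n →
    let open Occupation F k Q i n
        open Polynomials k N
    in (∀ α → IsMinimalMonomialGenerator J α → degree α ≡ n + 1)
       × (∃[ m ] (a≔ m) × (μ≔ m))
proposition4p1 F N Q i k n _ =
    degrees
  -- The common value is `length occupationVectors`: one list enumerates both the occupation vectors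
  -- and the minimal generators.
  , _
  , occupationVectors-cardinality F k Q i n
  , HasCardinality-⇔ (occupationVector⇔minimal F k Q i n) (occupationVectors-cardinality F k Q i n)
  where
  open Occupation F k Q i n
  open Polynomials k N

  degrees : ∀ α → IsMinimalMonomialGenerator J α → degree α ≡ n + 1
  degrees α min with Equivalence.from (occupationVector⇔minimal F k Q i n α) min
  -- A trajectory with `n` steps visits `suc n` states, and commutativity rewrites this as `n + 1`.
  ... | w , _ , refl = trans (degree-Ψ w) (+-comm 1 n)
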